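{- Let $M$ be a matroid on a finite ground set $E$, and let $e\in E$. If $e$ is not a loop of $M$, then for every $i$, $$L_i(M-e,M/e)=\bigoplus_{\substack{C\in\mathcal C(M)\\ e\in C}} L_i\bigl((C\setminus\{e\})\circ IN(M/C)\bigr),$$ where $L_i(M-e,M/e)$ denotes $L_i(IN(M)-e,\,IN(M)/e)$ and $\mathcal C(M)$ is the set of circuits of $M$.
   Context: A simplicial complex $\Delta$ on a finite vertex set $V$ is a collection of subsets of $V$ (faces) closed under taking subsets; the empty set is a face of dimension $-1$ of every complex having at least one face. Put $\dim F=|F|-1$. A simplicial pair $(\Delta,\Delta')$ consists of two simplicial complexes on the same vertex set; pairs with the same set difference $\Delta\setminus\Delta'$ are identified, and a pair is thus determined by the set of faces $\Delta\setminus\Delta'$. For $i\ge -1$, $C_i(\Delta,\Delta';\mathbb R)$ is the real vector space of formal linear combinations of oriented $i$-dimensional faces $[F]$, $F\in\Delta\setminus\Delta'$, and $\partial_i\colon C_i\to C_{i-1}$ is the usual signed simplicial boundary operator with all terms outside $\Delta\setminus\Delta'$ dropped; $\partial_i^*$ is its adjoint (transposed matrix in the natural bases). The Laplacian is $L_i(\Delta,\Delta')=\partial_{i+1}\partial_{i+1}^*+\partial_i^*\partial_i$, a linear operator on $C_i(\Delta,\Delta';\mathbb R)$. For a complex $\Delta$ and $e\in V$: $\Delta-e=\{F\in\Delta:e\notin F\}$ and $\Delta/e=\{F\setminus\{e\}:F\in\Delta,\ e\in F\}$, both on vertex set $V\setminus\{e\}$. $IN(M)$ is the simplicial complex on $E$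 whose faces are the independent sets of $M$, and $M/C$ is the matroid contraction of $M$ by $C$. If $A$ is a finite set disjoint from the vertex set of a simplicial complex $\Delta$, then $A\circ\Delta=\{A\cup F: F\in\Delta\}$; this is (the set of faces of) a simplicial pair, namely $(2^A*\Delta,\ (2^A\setminus\{A\})*\Delta)$, where $*$ is the join $\Delta_1*\Delta_2=\{F\cup G:F\in\Delta_1,G\in\Delta_2\}$. The direct sum is understood with respect to the decomposition of chain spaces $C_i$ into coordinate subspaces: the set of faces of $(IN(M)-e,IN(M)/e)$ is the disjoint union of the sets of faces $(C\setminus\{e\})\circ IN(M/C)$ over the circuits $C$ containing $e$, and $L_i$ respects this decomposition. If no circuit contains $e$ the direct sum is zero. -}

module Defs where

open import Level using (Level; 0ℓ; _⊔_)
open import Algebra.Bundles using (CommutativeRing)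
open import Data.Bool.Base using (if_then_else_)
open import Data.Fin.Base using (Fin; zero; suc)
open import Data.Fin.Properties using () renaming (_<?_ to _<ᶠ?_)
open import Data.Fin.Subset
open import Data.Fin.Subset.Properties
open import Data.Integer.Base as ℤ using (ℤ; +_; 1ℤ)
import Data.Integer.Properties as ℤ
open import Data.Irrelevant using ([_])
open import Data.List.Base using (List; []; _∷_; _++_; map; mapMaybe; foldr; allFin; filter; length)
import Data.Maybe.Base as Maybe
open import Data.Nat.Base as ℕ using (ℕ; zero; suc; _≤_; _<_)
import Data.Nat.Properties as ℕ
open import Data.Product.Base using (∃; ∃-syntax; _×_; _,_; proj₁; proj₂)
open import Data.Refinement using (Refinement-syntax; value; _,_)
open import Data.Sum.Base using (inj₁; inj₂; [_,_]′)
open import Data.Vec.Base using ([]; _∷_; here; there)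
import Data.Vec.Properties as Vec
import Data.Bool.Properties as Bool
open import Function.Base using (_∘_)
open import Relation.Binary.Definitions using (DecidableEquality)
open import Relation.Binary.PropositionalEquality
open import Relation.Nullary using (¬_; Dec; yes; no; does; contradiction; recompute)
open import Relation.Nullary.Decidable using (_×-dec_; _→-dec_; ¬?; map′; decidable-stable; dec⇒maybe)
open import Relation.Unary using (Pred; Decidable)

private
  variable
    n : ℕ
    E V W : Subset n

_≟ˢ_ : DecidableEquality (Subset n)
_≟ˢ_ = Vec.≡-dec Bool._≟_

subsets : ∀ n → List (Subset n)
subsets zero    = [] ∷ []
subsets (suc n) = map (outside ∷_) (subsets n) ++ map (inside ∷_) (subsets n)

private
  allSubset? : {P : Pred (Subset n) 0ℓ} → Decidable P → Dec (∀ p → P p)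
  allSubset? P? = map′
    (λ ¬∃ p → decidable-stable (P? p) (λ ¬p → ¬∃ (p , ¬p)))
    (λ all (p , ¬p) → ¬p (all p))
    (¬? (anySubset? (λ p → ¬? (P? p))))

  ∣p∪q∣≡∣p∣+∣q∣ : (p q : Subset n) → (∀ {x} → x ∈ p → x ∉ q) → ∣ p ∪ q ∣ ≡ ∣ p ∣ ℕ.+ ∣ q ∣
  ∣p∪q∣≡∣p∣+∣q∣ []            []            disj = refl
  ∣p∪q∣≡∣p∣+∣q∣ (inside  ∷ p) (inside  ∷ q) disj = contradiction here (disj here)
  ∣p∪q∣≡∣p∣+∣q∣ (inside  ∷ p) (outside ∷ q) disj =
    cong suc (∣p∪q∣≡∣p∣+∣q∣ p q (λ x∈p x∈q → disj (there x∈p) (there x∈q)))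
  ∣p∪q∣≡∣p∣+∣q∣ (outside ∷ p) (inside  ∷ q) disj =
    trans (cong suc (∣p∪q∣≡∣p∣+∣q∣ p q (λ x∈p x∈q → disj (there x∈p) (there x∈q))))
          (sym (ℕ.+-suc ∣ p ∣ ∣ q ∣))
  ∣p∪q∣≡∣p∣+∣q∣ (outside ∷ p) (outside ∷ q) disj =
    ∣p∪q∣≡∣p∣+∣q∣ p q (λ x∈p x∈q → disj (there x∈p) (there x∈q))

  x∈p─q⁻ : ∀ {x} (p q : Subset n) → x ∈ p ─ q → x ∈ p × x ∉ q
  x∈p─q⁻ (inside  ∷ p) (outside ∷ q) here = here , λ ()
  x∈p─q⁻ {x = zero} (inside  ∷ p) (inside ∷ q) ()
  x∈p─q⁻ {x = zero} (outside ∷ p) (inside ∷ q) ()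
  x∈p─q⁻ {x = zero} (outside ∷ p) (outside ∷ q) ()
  x∈p─q⁻ (_ ∷ p) (_ ∷ q) (there x∈) with x∈p─q⁻ p q x∈
  ... | x∈p , x∉q = there x∈p , λ { (there x∈q) → x∉q x∈q }

  ∪-mono-⊆ : {p p′ q q′ : Subset n} → p ⊆ p′ → q ⊆ q′ → p ∪ q ⊆ p′ ∪ q′
  ∪-mono-⊆ {p = p} {q = q} f g x∈ =
    x∈p∪q⁺ ([ inj₁ ∘ f , inj₂ ∘ g ]′ (x∈p∪q⁻ p q x∈))

  ∪-lub : {p q r : Subset n} → p ⊆ r → q ⊆ r → p ∪ q ⊆ r
  ∪-lub {p = p} {q = q} f g x∈ = [ f , g ]′ (x∈p∪q⁻ p q x∈)

  ⁅x⁆⊆p : ∀ {x} {p : Subset n} → x ∈ p → ⁅ x ⁆ ⊆ p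
  ⁅x⁆⊆p {x = x} {p} x∈p y∈ = subst (_∈ p) (sym (x∈⁅y⁆⇒x≡y x y∈)) x∈p

-- The ground set E is any subset of Fin n.  Classically every
-- predicate on subsets of a finite set is decidable, so Indep? is no
-- restriction on the matroid.

record Matroid {n} (E : Subset n) : Set₁ where
  field
    Indep      : Pred (Subset n) 0ℓ
    Indep?     : Decidable Indep
    ground     : ∀ {I} → Indep I → I ⊆ E
    empty      : Indep ⊥
    hereditary : ∀ {I J} → Indep J → I ⊆ J → Indep I
    augment    : ∀ {I J} → Indep I → Indep J → ∣ I ∣ < ∣ J ∣ →
                 ∃[ x ] x ∈ J × x ∉ I × Indep (I ∪ ⁅ x ⁆)

open Matroid

Circuit : Matroid {n} E → Pred (Subset n) 0ℓ
Circuit {E = E} M C = C ⊆ E × ¬ Indep M C × (∀ {D} → D ⊂ C → Indep M D)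

Loop : Matroid {n} E → Pred (Fin n) 0ℓ
Loop M e = Circuit M ⁅ e ⁆

-- The circuits containing e.  The proof component is irrelevant, so such
-- a circuit is just a set.
CircuitThrough : Matroid {n} E → Fin n → Set
CircuitThrough {n} M e = [ C ∈ Subset n ∣ Circuit M C × e ∈ C ]

-- B is a basis of T, that is, of the restriction of M to T.
Basis : Matroid {n} E → Subset n → Pred (Subset n) 0ℓ
Basis M T B = B ⊆ T × Indep M B × (∀ B′ → B′ ⊆ T × Indep M B′ × B ⊆ B′ → B ≡ B′)

module _ (M : Matroid {n} E) (T : Subset n) where

  private
    Basis? : Decidable (Basis M T)
    Basis? B = (B ⊆? T) ×-dec Indep? M B ×-dec
      allSubset? (λ B′ → ((B′ ⊆? T) ×-dec Indep? M B′ ×-dec (B ⊆? B′)) →-dec (B ≟ˢ B′))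

    Larger : Subset n → Pred (Subset n) 0ℓ
    Larger B B′ = B′ ⊆ T × Indep M B′ × B ⊂ B′

    Larger? : ∀ B → Decidable (Larger B)
    Larger? B B′ = (B′ ⊆? T) ×-dec Indep? M B′ ×-dec (B ⊂? B′)

    extend : ∀ k B → n ≤ k ℕ.+ ∣ B ∣ → B ⊆ T → Indep M B → ∃ (Basis M T)
    extend k B n≤ B⊆T indB with anySubset? (Larger? B)
    extend zero B n≤ _ _ | yes (B′ , _ , _ , B⊂B′) =
      contradiction (ℕ.<-≤-trans (p⊂q⇒∣p∣<∣q∣ B⊂B′) (∣p∣≤n B′)) (ℕ.≤⇒≯ n≤)
    extend (suc k) B n≤ _ _ | yes (B′ , B′⊆T , indB′ , B⊂B′) =
      extend k B′ (ℕ.≤-trans n≤ (ℕ.≤-trans (ℕ.≤-reflexive (sym (ℕ.+-suc k ∣ B ∣)))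
                                           (ℕ.+-monoʳ-≤ k (p⊂q⇒∣p∣<∣q∣ B⊂B′))))
             B′⊆T indB′
    ... | no maximal = B , B⊆T , indB , λ B′ (B′⊆T , indB′ , B⊆B′) →
      ⊆-antisym B⊆B′ λ {x} x∈B′ → decidable-stable (x ∈? B)
        λ x∉B → maximal (B′ , B′⊆T , indB′ , B⊆B′ , x , x∈B′ , x∉B)

    absorb : ∀ {B x} → Basis M T B → x ∈ T → Indep M (B ∪ ⁅ x ⁆) → x ∈ B
    absorb {B} {x} (B⊆T , _ , maximal) x∈T ind = subst (x ∈_)
      (sym (maximal (B ∪ ⁅ x ⁆) (∪-lub B⊆T (⁅x⁆⊆p x∈T) , ind , p⊆p∪q ⁅ x ⁆)))
      (q⊆p∪q B ⁅ x ⁆ (x∈⁅x⁆ x))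

    ∣B∣≤∣B′∣ : ∀ {B B′} → Basis M T B → Basis M T B′ → ∣ B ∣ ≤ ∣ B′ ∣
    ∣B∣≤∣B′∣ bas@(B⊆T , indB , _) bas′@(_ , indB′ , _) = ℕ.≮⇒≥ λ lt →
      let x , x∈B , x∉B′ , ind = augment M indB′ indB lt
      in x∉B′ (absorb bas′ (B⊆T x∈B) ind)

    IndepIn/ : Pred (Subset n) 0ℓ
    IndepIn/ I = I ⊆ E ─ T × ∃[ B ] Basis M T B × Indep M (B ∪ I)

    augment/ : ∀ {I J} → IndepIn/ I → IndepIn/ J → ∣ I ∣ < ∣ J ∣ →
               ∃[ x ] x ∈ J × x ∉ I × IndepIn/ (I ∪ ⁅ x ⁆)
    augment/ {I} {J} (I⊆ , B , bas , ind) (J⊆ , B′ , bas′ , ind′) lt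
      with augment M ind ind′ larger
      where
      size : ∀ {A K} → Basis M T A → K ⊆ E ─ T → ∣ A ∪ K ∣ ≡ ∣ A ∣ ℕ.+ ∣ K ∣
      size {A} {K} (A⊆T , _) K⊆ = ∣p∪q∣≡∣p∣+∣q∣ A K
        λ x∈A x∈K → proj₂ (x∈p─q⁻ E T (K⊆ x∈K)) (A⊆T x∈A)
      larger : ∣ B ∪ I ∣ < ∣ B′ ∪ J ∣
      larger = subst₂ _<_ (sym (size bas I⊆)) (sym (size bas′ J⊆))
        (ℕ.+-mono-≤-< (∣B∣≤∣B′∣ bas bas′) lt)
    ... | x , x∈ , x∉ , indx with x∈p∪q⁻ B′ J x∈
    ...   | inj₁ x∈B′ = contradiction
              (p⊆p∪q I (absorb bas (proj₁ bas′ x∈B′)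
                (hereditary M indx (∪-mono-⊆ (p⊆p∪q I) (λ y∈ → y∈)))))
              x∉
    ...   | inj₂ x∈J = x , x∈J , x∉ ∘ q⊆p∪q B I ,
              ∪-lub I⊆ (⁅x⁆⊆p (J⊆ x∈J)) , B , bas ,
              subst (Indep M) (∪-assoc B I ⁅ x ⁆) indx

  infixl 5 _/_

  -- I is independent in M / T when B ∪ I is independent in M for a
  -- basis B of T (for one basis or for all of them: the same).
  _/_ : Matroid (E ─ T)
  _/_ = record
    { Indep      = IndepIn/
    ; Indep?     = λ I → (I ⊆? (E ─ T)) ×-dec
                     anySubset? (λ B → Basis? B ×-dec Indep? M (B ∪ I))
    ; ground     = λ (I⊆ , _) → I⊆
    ; empty      = ⊆-min _ ,
                   (let B , bas = extend n ⊥ (ℕ.m≤m+n n _) (⊆-min T) (empty M)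
                    in B , bas , subst (Indep M) (sym (∪-identityʳ B)) (proj₁ (proj₂ bas)))
    ; hereditary = λ (J⊆ , B , bas , ind) I⊆J →
                     J⊆ ∘ I⊆J , B , bas , hereditary M ind (∪-mono-⊆ (λ x∈ → x∈) I⊆J)
    ; augment    = augment/
    }

-- V is the vertex set.  The complex without any face, not even ∅, is allowed.

record Complex {n} (V : Subset n) : Set₁ where
  field
    Face     : Pred (Subset n) 0ℓ
    Face?    : Decidable Face
    vertices : ∀ {F} → Face F → F ⊆ V
    down     : ∀ {F G} → Face F → G ⊆ F → Face G

open Complex

IN : Matroid {n} E → Complex E
IN M = record
  { Face = Indep M ; Face? = Indep? M ; vertices = ground M ; down = hereditary M }

infixl 5 _∖ᶜ_ _/ᶜ_

-- Δ ∖ᶜ e is Δ − e.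
_∖ᶜ_ : Complex {n} V → (e : Fin n) → Complex (V - e)
Δ ∖ᶜ e = record
  { Face     = λ F → Face Δ F × e ∉ F
  ; Face?    = λ F → Face? Δ F ×-dec ¬? (e ∈? F)
  ; vertices = λ (ΔF , e∉F) x∈F → x∈p∧x≢y⇒x∈p-y (vertices Δ ΔF x∈F)
                 λ { refl → e∉F x∈F }
  ; down     = λ (ΔF , e∉F) G⊆F → down Δ ΔF G⊆F , e∉F ∘ G⊆F
  }

-- Δ /ᶜ e is Δ / e.
_/ᶜ_ : Complex {n} V → (e : Fin n) → Complex (V - e)
_/ᶜ_ {n} {V} Δ e = record
  { Face     = λ F → ∃[ G ] Face Δ G × e ∈ G × F ≡ G - e
  ; Face?    = λ F → anySubset? λ G → Face? Δ G ×-dec (e ∈? G) ×-dec (F ≟ˢ (G - e))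
  ; vertices = λ { (G , ΔG , e∈G , refl) x∈ →
                 let x∈G , x∉e = x∈p─q⁻ G ⁅ e ⁆ x∈
                 in x∈p∧x∉q⇒x∈p─q (vertices Δ ΔG x∈G) x∉e }
  ; down     = λ { {G = H} (G , ΔG , e∈G , refl) H⊆ →
                 H ∪ ⁅ e ⁆
                 , down Δ ΔG (∪-lub (λ x∈H → proj₁ (x∈p─q⁻ G ⁅ e ⁆ (H⊆ x∈H))) (⁅x⁆⊆p e∈G))
                 , q⊆p∪q H ⁅ e ⁆ (x∈⁅x⁆ e)
                 , ⊆-antisym
                     (λ x∈H → x∈p∧x∉q⇒x∈p─q (p⊆p∪q ⁅ e ⁆ x∈H)
                                (proj₂ (x∈p─q⁻ G ⁅ e ⁆ (H⊆ x∈H))))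
                     (λ x∈ → let x∈∪ , x∉e = x∈p─q⁻ (H ∪ ⁅ e ⁆) ⁅ e ⁆ x∈
                             in [ (λ x∈H → x∈H) , (λ x∈e → contradiction x∈e x∉e) ]′
                                  (x∈p∪q⁻ H ⁅ e ⁆ x∈∪)) }
  }

infixr 6 _*ᶜ_

_*ᶜ_ : Complex {n} V → Complex {n} W → Complex (V ∪ W)
Δ₁ *ᶜ Δ₂ = record
  { Face     = λ H → ∃[ F ] ∃[ G ] Face Δ₁ F × Face Δ₂ G × H ≡ F ∪ G
  ; Face?    = λ H → anySubset? λ F → anySubset? λ G →
                 Face? Δ₁ F ×-dec Face? Δ₂ G ×-dec (H ≟ˢ (F ∪ G))
  ; vertices = λ { (F , G , Δ₁F , Δ₂G , refl) →
                 ∪-mono-⊆ (vertices Δ₁ Δ₁F) (vertices Δ₂ Δ₂G) }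
  ; down     = λ { {G = K} (F , G , Δ₁F , Δ₂G , refl) K⊆ →
                 K ∩ F , K ∩ G , down Δ₁ Δ₁F (p∩q⊆q K F) , down Δ₂ Δ₂G (p∩q⊆q K G)
                 , trans (⊆-antisym (λ x∈K → x∈p∩q⁺ (x∈K , K⊆ x∈K)) (p∩q⊆p K (F ∪ G)))
                         (∩-distribˡ-∪ K F G) }
  }

-- 2^A
simplex : (A : Subset n) → Complex A
simplex A = record
  { Face = _⊆ A ; Face? = _⊆? A ; vertices = λ F⊆A → F⊆A ; down = λ F⊆A G⊆F → F⊆A ∘ G⊆F }

-- 2^A ∖ {A}
simplexBoundary : (A : Subset n) → Complex A
simplexBoundary A = record
  { Face = _⊂ A ; Face? = _⊂? A ; vertices = proj₁ ; down = λ F⊂A G⊆F → ⊆-⊂-trans G⊆F F⊂A }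

infix 4 _,ᵖ_ _∈ᵖ_ _∈ᵖ?_

record Pair {n} (V : Subset n) : Set₁ where
  constructor _,ᵖ_
  field
    big small : Complex V

open Pair

_∈ᵖ_ : Subset n → Pair {n} V → Set
F ∈ᵖ P = Face (big P) F × ¬ Face (small P) F

_∈ᵖ?_ : (F : Subset n) (P : Pair {n} V) → Dec (F ∈ᵖ P)
F ∈ᵖ? P = Face? (big P) F ×-dec ¬? (Face? (small P) F)

infixr 6 _∘ᵖ_

-- A ∘ᵖ Δ is meant for A disjoint from the vertex set of Δ; its faces are
-- then the sets A ∪ F with F a face of Δ.
_∘ᵖ_ : (A : Subset n) → Complex {n} V → Pair (A ∪ V)
A ∘ᵖ Δ = (simplex A *ᶜ Δ) ,ᵖ (simplexBoundary A *ᶜ Δ)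

record DisjointUnion {n} {V : Subset n} (P : Pair V)
                     {K : Set} {W : K → Subset n} (Q : ∀ k → Pair (W k)) : Set where
  field
    cover    : ∀ {F} → F ∈ᵖ P → ∃[ k ] F ∈ᵖ Q k
    include  : ∀ k {F} → F ∈ᵖ Q k → F ∈ᵖ P
    disjoint : ∀ {k l F} → F ∈ᵖ Q k → F ∈ᵖ Q l → k ≡ l

open DisjointUnion

dim : Subset n → ℤ
dim F = + ∣ F ∣ ℤ.- 1ℤ

-- The proof component is irrelevant, so a cell is just a set.
Cell : Pair {n} V → ℤ → Set
Cell {n} P i = [ F ∈ Subset n ∣ (F ∈ᵖ P) × (dim F ≡ i) ]

cells : (P : Pair {n} V) (i : ℤ) → List (Cell P i)
cells {n} P i = mapMaybe
  (λ F → Maybe.map (λ p → F , [ p ]) (dec⇒maybe ((F ∈ᵖ? P) ×-dec (dim F ℤ.≟ i))))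
  (subsets n)

-- Coefficients lie in an arbitrary commutative
-- ring, the real numbers being one instance.

module Chains {c ℓ : Level} (R : CommutativeRing c ℓ) where

  open CommutativeRing R
    using (Carrier; _≈_; 0#; 1#; semiring)
    renaming (_+_ to _+ʳ_; _*_ to _*ʳ_; -_ to -ʳ_)
  open import Algebra.Properties.Semiring.Exp semiring using (_^_)

  ∑ : {A : Set} → List A → (A → Carrier) → Carrier
  ∑ xs f = foldr _+ʳ_ 0# (map f xs)

  -- C_i(P), in the basis of faces oriented by the order of Fin n.
  Chain : Pair {n} V → ℤ → Set c
  Chain P i = Cell P i → Carrier

  EqualOn : (P : Pair {n} V) (i : ℤ) (S T : Chain P i → Chain P i) → Set (c ⊔ ℓ)
  EqualOn P i S T = ∀ x F → S x F ≈ T x F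

  -- The coefficient of [G] in the boundary ∂[F] = Σ_{v ∈ F} (−1)^{pos v} [F − v],
  -- where pos v is the number of vertices of F preceding v.
  incidence : (G F : Subset n) → Carrier
  incidence {n} G F = ∑ (allFin n) λ v →
    if does ((v ∈? F) ×-dec (G ≟ˢ (F - v))) then (-ʳ 1#) ^ pos v else 0#
    where
    pos : Fin n → ℕ
    pos v = length (filter (λ u → (u ∈? F) ×-dec (u <ᶠ? v)) (allFin n))

  module _ (P : Pair {n} V) where

    -- ∂ i j≡i-1 and ∂* i j≡i-1 are ∂_i : C_i → C_j and its transpose.  Taking
    -- j = i − 1 only up to _≡_ lets ∂_{i+1} end in C_i on the nose.
    ∂ : ∀ i {j} → j ≡ i ℤ.- 1ℤ → Chain P i → Chain P j
    ∂ i _ x G = ∑ (cells P i) λ F → incidence (value G) (value F) *ʳ x F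

    ∂* : ∀ i {j} → j ≡ i ℤ.- 1ℤ → Chain P j → Chain P i
    ∂* i {j} _ y F = ∑ (cells P j) λ G → incidence (value G) (value F) *ʳ y G

    private
      [i+1]-1 : ∀ i → i ≡ (i ℤ.+ 1ℤ) ℤ.- 1ℤ
      [i+1]-1 i = sym (trans (ℤ.+-assoc i 1ℤ (ℤ.- 1ℤ)) (ℤ.+-identityʳ i))

    L : ∀ i → Chain P i → Chain P i
    L i x F = ∂  (i ℤ.+ 1ℤ) ([i+1]-1 i) (∂* (i ℤ.+ 1ℤ) ([i+1]-1 i) x) F
           +ʳ ∂* i refl (∂ i refl x) F

  module _ {P : Pair {n} V} {K : Set} {W : K → Subset n} {Q : ∀ k → Pair (W k)}
           (D : DisjointUnion P Q) where

    -- The projection of C_i(P) onto the coordinate subspace C_i(Q k).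
    project : ∀ k {i} → Chain P i → Chain (Q k) i
    project k x (F , [ p ]) = x (F , [ include D k (proj₁ p) , proj₂ p ])

    -- The direct sum of operators T k on C_i(Q k), as an operator on C_i(P):
    -- its F-coordinate is computed in the block containing F.
    ⨁ : ∀ {i} → (∀ k → Chain (Q k) i → Chain (Q k) i) → Chain P i → Chain P i
    ⨁ T x (F , [ p ]) =
      let k , F∈Qk = cover D (recompute (F ∈ᵖ? P) (proj₁ p))
      in T k (project k x) (F , [ F∈Qk , proj₂ p ])

{-# OPTIONS --safe #-}

-- A face of (IN(M) − e, IN(M)/e) is an independent set F ∌ e with F ∪ e
-- dependent.  Such an F contains C − e for a unique circuit C ∋ e, and the
-- faces with a given C are exactly those of (C − e) ∘ IN(M/C).  If F ⊆ G are
-- two faces of the pair, then C − e ⊆ F ⊆ G, so F and G have the same C.  As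
-- the incidence [F : G] vanishes unless F ⊆ G, the boundary maps and their
-- transposes, hence the Laplacian, are block diagonal.

module Submission where

open import Level using (Level)
open import Algebra.Bundles using (CommutativeRing)
open import Data.Bool.Base using (if_then_else_)
open import Data.Empty using (⊥-elim-irr)
open import Data.Fin.Base using (Fin)
open import Data.Fin.Subset
open import Data.Fin.Subset.Induction using (Acc; acc; ⊂-wellFounded; ⊃-wellFounded)
open import Data.Fin.Subset.Properties
open import Data.Integer.Base as ℤ using (ℤ; 1ℤ)
import Data.Integer.Properties as ℤ
open import Data.Irrelevant using ([_])
open import Data.List.Base using (List; []; _∷_; mapMaybe; allFin)
open import Data.Maybe.Base as Maybe using (Maybe; just; nothing; maybe′)
open import Data.Nat.Base using (ℕ; _≤_; _+_; s≤s⁻¹)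
import Data.Nat.Properties as ℕ
open import Data.Product.Base using (Σ-syntax; ∃-syntax; _×_; _,_; proj₁; proj₂)
open import Data.Refinement using (value; _,_)
open import Data.Refinement.Properties using (value-injective)
open import Data.Sum.Base using (inj₁; inj₂; [_,_]′)
open import Data.Vec.Base using ([]; _∷_; there)
open import Function.Base using (_∘_; id)
open import Relation.Binary.PropositionalEquality
  using (_≡_; refl; sym; trans; cong; subst; module ≡-Reasoning)
open import Relation.Nullary using (¬_; Dec; yes; no; does; contradiction; recompute)
open import Relation.Nullary.Decidable using (_×-dec_; ¬?; decidable-stable; dec⇒maybe)
open import Defs

private
  variable
    n : ℕ
    E V W : Subset n

-- Finite subsets and their cardinalities

x∈p─q⇒x∉q : ∀ {x} (p q : Subset n) → x ∈ p ─ q → x ∉ q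
x∈p─q⇒x∉q (_ ∷ p) (_ ∷ q) (there x∈p─q) (there x∈q) = x∈p─q⇒x∉q p q x∈p─q x∈q

p-x⊆q⇒p⊆q : ∀ {x} {p q : Subset n} → p - x ⊆ q → x ∈ q → p ⊆ q
p-x⊆q⇒p⊆q {x = x} {p} p-x⊆q x∈q {y} y∈p with y ∈? ⁅ x ⁆
... | yes y∈x = subst (_∈ _) (sym (x∈⁅y⁆⇒x≡y x y∈x)) x∈q
... | no  y∉x = p-x⊆q (x∈p∧x∉q⇒x∈p─q y∈p y∉x)

∪-lub : {p q r : Subset n} → p ⊆ r → q ⊆ r → p ∪ q ⊆ r
∪-lub {p = p} {q} p⊆r q⊆r x∈ = [ p⊆r , q⊆r ]′ (x∈p∪q⁻ p q x∈)

x∈p⇒⁅x⁆⊆p : ∀ {x} {p : Subset n} → x ∈ p → ⁅ x ⁆ ⊆ p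
x∈p⇒⁅x⁆⊆p {x = x} x∈p y∈x = subst (_∈ _) (sym (x∈⁅y⁆⇒x≡y x y∈x)) x∈p

p⊆q∧∣q∣≤∣p∣⇒q⊆p : {p q : Subset n} → p ⊆ q → ∣ q ∣ ≤ ∣ p ∣ → q ⊆ p
p⊆q∧∣q∣≤∣p∣⇒q⊆p {p = p} p⊆q ∣q∣≤∣p∣ {x} x∈q = decidable-stable (x ∈? p) λ x∉p →
  ℕ.≤⇒≯ ∣q∣≤∣p∣ (p⊂q⇒∣p∣<∣q∣ (p⊆q , x , x∈q , x∉p))

∣p∪q∣+∣p∩q∣≡∣p∣+∣q∣ : (p q : Subset n) → ∣ p ∪ q ∣ + ∣ p ∩ q ∣ ≡ ∣ p ∣ + ∣ q ∣
∣p∪q∣+∣p∩q∣≡∣p∣+∣q∣ []            []            = refl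
∣p∪q∣+∣p∩q∣≡∣p∣+∣q∣ (outside ∷ p) (outside ∷ q) = ∣p∪q∣+∣p∩q∣≡∣p∣+∣q∣ p q
∣p∪q∣+∣p∩q∣≡∣p∣+∣q∣ (inside  ∷ p) (outside ∷ q) = cong ℕ.suc (∣p∪q∣+∣p∩q∣≡∣p∣+∣q∣ p q)
∣p∪q∣+∣p∩q∣≡∣p∣+∣q∣ (outside ∷ p) (inside  ∷ q) =
  trans (cong ℕ.suc (∣p∪q∣+∣p∩q∣≡∣p∣+∣q∣ p q)) (sym (ℕ.+-suc ∣ p ∣ ∣ q ∣))
∣p∪q∣+∣p∩q∣≡∣p∣+∣q∣ (inside  ∷ p) (inside  ∷ q) = cong ℕ.suc
  (trans (ℕ.+-suc ∣ p ∪ q ∣ ∣ p ∩ q ∣)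
    (trans (cong ℕ.suc (∣p∪q∣+∣p∩q∣≡∣p∣+∣q∣ p q)) (sym (ℕ.+-suc ∣ p ∣ ∣ q ∣))))

∣p∪q∣≤∣p∣+∣q∣ : (p q : Subset n) → ∣ p ∪ q ∣ ≤ ∣ p ∣ + ∣ q ∣
∣p∪q∣≤∣p∣+∣q∣ p q = subst (∣ p ∪ q ∣ ≤_) (∣p∪q∣+∣p∩q∣≡∣p∣+∣q∣ p q) (ℕ.m≤m+n ∣ p ∪ q ∣ ∣ p ∩ q ∣)

∣p∪q∣≡∣p∣+∣q∣ : (p q : Subset n) → (∀ {x} → x ∈ p → x ∉ q) → ∣ p ∪ q ∣ ≡ ∣ p ∣ + ∣ q ∣
∣p∪q∣≡∣p∣+∣q∣ {n} p q disjoint = begin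
  ∣ p ∪ q ∣              ≡⟨ ℕ.+-identityʳ _ ⟨
  ∣ p ∪ q ∣ + 0          ≡⟨ cong (∣ p ∪ q ∣ +_) (∣⊥∣≡0 n) ⟨
  ∣ p ∪ q ∣ + ∣ ⊥ {n} ∣  ≡⟨ cong (λ r → ∣ p ∪ q ∣ + ∣ r ∣) p∩q≡⊥ ⟨
  ∣ p ∪ q ∣ + ∣ p ∩ q ∣  ≡⟨ ∣p∪q∣+∣p∩q∣≡∣p∣+∣q∣ p q ⟩
  ∣ p ∣ + ∣ q ∣          ∎
  where
  open ≡-Reasoning
  p∩q≡⊥ : p ∩ q ≡ ⊥
  p∩q≡⊥ = Empty-unique λ (x , x∈) → let x∈p , x∈q = x∈p∩q⁻ p q x∈ in disjoint x∈p x∈q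

-- Faces of the pair `A ∘ᵖ Δ`

module _ {A : Subset n} {Δ : Complex {n} V} where

  open Complex Δ

  -- If `A′` missed a vertex of `A`, the same decomposition `A′ ∪ G` would make `F` a face of the
  -- small complex.
  ∈∘ᵖ⁻ : ∀ {F} → F ∈ᵖ A ∘ᵖ Δ → ∃[ G ] Face G × F ≡ A ∪ G
  ∈∘ᵖ⁻ ((A′ , G , A′⊆A , ΔG , refl) , ∉small) = G , ΔG , cong (_∪ G) (⊆-antisym A′⊆A A⊆A′)
    where
    A⊆A′ : A ⊆ A′
    A⊆A′ {x} x∈A = decidable-stable (x ∈? A′) λ x∉A′ →
      ∉small (A′ , G , (A′⊆A , x , x∈A , x∉A′) , ΔG , refl)

  -- A decomposition `A′ ∪ G′` in the small complex leaves some `x ∈ A` out of `A′`; disjointness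
  -- keeps `x` out of `G′` as well.
  ∈∘ᵖ⁺ : (∀ {x} → x ∈ A → x ∉ V) → ∀ {G} → Face G → A ∪ G ∈ᵖ A ∘ᵖ Δ
  ∈∘ᵖ⁺ disjoint {G} ΔG = (A , G , id , ΔG , refl) ,
    λ (A′ , G′ , (_ , x , x∈A , x∉A′) , ΔG′ , A∪G≡) →
      [ x∉A′ , disjoint x∈A ∘ vertices ΔG′ ]′
        (x∈p∪q⁻ A′ G′ (subst (x ∈_) A∪G≡ (p⊆p∪q G x∈A)))

-- Exchange arguments and circuits

module _ (M : Matroid {n} E) where

  open Matroid M

  -- Recovers the proof erased in `CircuitThrough` piece by piece: inclusion and independence are
  -- decidable, and dependence is a negation.
  recomputeCircuit : ∀ {C} → .(Circuit M C) → Circuit M C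
  recomputeCircuit {C} circuit =
    recompute (C ⊆? E) (proj₁ circuit) ,
    (λ indC → ⊥-elim-irr (proj₁ (proj₂ circuit) indC)) ,
    λ {D} D⊂C → recompute (Indep? D) (proj₂ (proj₂ circuit) D⊂C)

  -- Augmentation from `J`, iterated while the growing set is smaller than `J`.
  augmentTo : ∀ {I J} → Indep I → Indep J →
              ∃[ K ] Indep K × I ⊆ K × K ⊆ I ∪ J × ∣ J ∣ ≤ ∣ K ∣
  augmentTo {I} {J} indI indJ = go I (⊃-wellFounded I) indI
    where
    go : ∀ I → Acc _⊃_ I → Indep I → ∃[ K ] Indep K × I ⊆ K × K ⊆ I ∪ J × ∣ J ∣ ≤ ∣ K ∣
    go I (acc rec) indI with ∣ I ∣ ℕ.<? ∣ J ∣
    ... | no  ≮ = I , indI , id , p⊆p∪q J , ℕ.≮⇒≥ ≮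
    ... | yes < with augment indI indJ <
    ...   | x , x∈J , x∉I , indIx
      with go (I ∪ ⁅ x ⁆) (rec (p⊆p∪q ⁅ x ⁆ , x , q⊆p∪q I ⁅ x ⁆ (x∈⁅x⁆ x) , x∉I)) indIx
    ...     | K , indK , Ix⊆K , K⊆ , ∣J∣≤∣K∣ =
      K , indK , Ix⊆K ∘ p⊆p∪q ⁅ x ⁆ ,
      ∪-lub (∪-lub (p⊆p∪q J) (q⊆p∪q I J ∘ x∈p⇒⁅x⁆⊆p x∈J)) (q⊆p∪q I J) ∘ K⊆ , ∣J∣≤∣K∣

  -- Descend through dependent proper subsets; a set with no further descent is a circuit.
  dependent⇒circuit⊆ : ∀ {T} → T ⊆ E → ¬ Indep T → ∃[ C ] C ⊆ T × Circuit M C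
  dependent⇒circuit⊆ {T} = go T (⊂-wellFounded T)
    where
    go : ∀ T → Acc _⊂_ T → T ⊆ E → ¬ Indep T → ∃[ C ] C ⊆ T × Circuit M C
    go T (acc rec) T⊆E depT with anySubset? (λ D → (D ⊂? T) ×-dec ¬? (Indep? D))
    ... | no  minimal = T , id , T⊆E , depT ,
      λ {D} D⊂T → decidable-stable (Indep? D) λ depD → minimal (D , D⊂T , depD)
    ... | yes (D , D⊂T , depD) with go D (rec D⊂T) (T⊆E ∘ proj₁ D⊂T) depD
    ...   | C , C⊆D , circuit = C , proj₁ D⊂T ∘ C⊆D , circuit

  -- If x ∈ C ∖ D, then C − x extends within F ∪ e to an independent set of
  -- size |F|, which can only be (F ∪ e) − x; but that contains D.
  fundamentalCircuit-⊆ : ∀ {C D F e} → Circuit M C → Circuit M D → e ∈ C → e ∈ D →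
    Indep F → C - e ⊆ F → D - e ⊆ F → C ⊆ D
  fundamentalCircuit-⊆ {C} {D} {F} {e} (_ , depC , minC) (_ , depD , _) e∈C e∈D indF C-e⊆F D-e⊆F {x} x∈C =
    decidable-stable (x ∈? D) λ x∉D →
      let
        x∈Fe = p-x⊆q⇒p⊆q (p⊆p∪q ⁅ e ⁆ ∘ C-e⊆F) e∈F∪e x∈C
        C-x⊆Fe : C - x ⊆ F ∪ ⁅ e ⁆
        C-x⊆Fe = p-x⊆q⇒p⊆q {p = C} (p⊆p∪q ⁅ e ⁆ ∘ C-e⊆F) e∈F∪e ∘ p─q⊆p C ⁅ x ⁆
        K , indK , C-x⊆K , K⊆ , ∣F∣≤∣K∣ = augmentTo (minC (x∈p⇒p-x⊂p x∈C)) indF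
        x∉K : x ∉ K
        x∉K x∈K = depC (hereditary indK (p-x⊆q⇒p⊆q C-x⊆K x∈K))
        K⊆Fe-x : K ⊆ (F ∪ ⁅ e ⁆) - x
        K⊆Fe-x y∈K = x∈p∧x≢y⇒x∈p-y (∪-lub C-x⊆Fe (p⊆p∪q ⁅ e ⁆) (K⊆ y∈K)) λ { refl → x∉K y∈K }
        Fe-x⊆K : (F ∪ ⁅ e ⁆) - x ⊆ K
        Fe-x⊆K = p⊆q∧∣q∣≤∣p∣⇒q⊆p K⊆Fe-x (ℕ.≤-trans (∣Fe-x∣≤∣F∣ x∈Fe) ∣F∣≤∣K∣)
      in depD (hereditary indK λ y∈D →
           Fe-x⊆K (x∈p∧x≢y⇒x∈p-y (p-x⊆q⇒p⊆q (p⊆p∪q ⁅ e ⁆ ∘ D-e⊆F) e∈F∪e y∈D) λ { refl → x∉D y∈D }))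
    where
    e∈F∪e : e ∈ F ∪ ⁅ e ⁆
    e∈F∪e = q⊆p∪q F ⁅ e ⁆ (x∈⁅x⁆ e)
    ∣Fe-x∣≤∣F∣ : ∀ {x} → x ∈ F ∪ ⁅ e ⁆ → ∣ (F ∪ ⁅ e ⁆) - x ∣ ≤ ∣ F ∣
    ∣Fe-x∣≤∣F∣ {x} x∈Fe = s≤s⁻¹ (begin-strict
      ∣ (F ∪ ⁅ e ⁆) - x ∣  <⟨ x∈p⇒∣p-x∣<∣p∣ x∈Fe ⟩
      ∣ F ∪ ⁅ e ⁆ ∣        ≤⟨ ∣p∪q∣≤∣p∣+∣q∣ F ⁅ e ⁆ ⟩
      ∣ F ∣ + ∣ ⁅ e ⁆ ∣    ≡⟨ cong (∣ F ∣ +_) (∣⁅x⁆∣≡1 e) ⟩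
      ∣ F ∣ + 1            ≡⟨ ℕ.+-comm ∣ F ∣ 1 ⟩
      ℕ.suc ∣ F ∣          ∎)
      where open ℕ.≤-Reasoning

  -- The block of a single circuit

  module _ {C e} (circuit : Circuit M C) (e∈C : e ∈ C) where

    private
      A = C - e
      C⊆E = proj₁ circuit
      depC = proj₁ (proj₂ circuit)
      A⊆C : A ⊆ C
      A⊆C = p─q⊆p C ⁅ e ⁆
      indA : Indep A
      indA = proj₂ (proj₂ circuit) (x∈p⇒p-x⊂p e∈C)

    A⊆indep⇒e∉ : ∀ {I} → Indep I → A ⊆ I → e ∉ I
    A⊆indep⇒e∉ indI A⊆I e∈I = depC (hereditary indI (p-x⊆q⇒p⊆q A⊆I e∈I))

    -- The only element of `C` outside `A` is `e`, and adding it would put all of `C` inside `I`.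
    A⊆indep⇒∩C⊆A : ∀ {I x} → Indep I → A ⊆ I → x ∈ I → x ∈ C → x ∈ A
    A⊆indep⇒∩C⊆A indI A⊆I x∈I x∈C =
      x∈p∧x≢y⇒x∈p-y x∈C λ { refl → A⊆indep⇒e∉ indI A⊆I x∈I }

    -- Augmenting `B` from `A` stays inside `C`, so maximality of `B` makes the result `B` itself.
    ∣A∣≤∣basis∣ : ∀ {B} → Basis M C B → ∣ A ∣ ≤ ∣ B ∣
    ∣A∣≤∣basis∣ (B⊆C , indB , maximal) with augmentTo indB indA
    ... | K , indK , B⊆K , K⊆ , ∣A∣≤∣K∣ =
      subst (λ X → ∣ A ∣ ≤ ∣ X ∣) (sym (maximal K (∪-lub B⊆C A⊆C ∘ K⊆ , indK , B⊆K))) ∣A∣≤∣K∣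

    -- Independence in `M / C` comes with some basis `B` of `C`, to be exchanged for `A`. Extend `A`
    -- by elements of `B ∪ G` to an independent `K` with at least as many elements as `B ∪ G`. Since
    -- `K` meets `C` only in `A`, it lies in `A ∪ G`, and counting forces equality.
    contractionIndep⇒A∪G-indep : ∀ {G} → Matroid.Indep (M / C) G → Indep (A ∪ G)
    contractionIndep⇒A∪G-indep {G} (G⊆E─C , B , basis@(B⊆C , _) , indB∪G)
      with augmentTo indA indB∪G
    ... | K , indK , A⊆K , K⊆ , ∣B∪G∣≤∣K∣ =
      hereditary indK (p⊆q∧∣q∣≤∣p∣⇒q⊆p K⊆A∪G (ℕ.≤-trans ∣A∪G∣≤∣B∪G∣ ∣B∪G∣≤∣K∣))
      where
      K⊆A∪G : K ⊆ A ∪ G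
      K⊆A∪G x∈K = [ p⊆p∪q G , [ p⊆p∪q G ∘ A⊆indep⇒∩C⊆A indK A⊆K x∈K ∘ B⊆C , q⊆p∪q A G ]′
                                ∘ x∈p∪q⁻ B G ]′
                  (x∈p∪q⁻ A (B ∪ G) (K⊆ x∈K))
      ∣A∪G∣≤∣B∪G∣ : ∣ A ∪ G ∣ ≤ ∣ B ∪ G ∣
      ∣A∪G∣≤∣B∪G∣ = begin
        ∣ A ∪ G ∣      ≤⟨ ∣p∪q∣≤∣p∣+∣q∣ A G ⟩
        ∣ A ∣ + ∣ G ∣  ≤⟨ ℕ.+-monoˡ-≤ ∣ G ∣ (∣A∣≤∣basis∣ basis) ⟩
        ∣ B ∣ + ∣ G ∣  ≡⟨ ∣p∪q∣≡∣p∣+∣q∣ B G (λ x∈B x∈G → x∈p─q⇒x∉q E C (G⊆E─C x∈G) (B⊆C x∈B)) ⟨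
        ∣ B ∪ G ∣      ∎
        where open ℕ.≤-Reasoning

    -- Together with `∈block⁺` this identifies the block of `C` with the independent sets containing
    -- `C - e`, the form used from here on.
    ∈block⁻ : ∀ {F} → F ∈ᵖ A ∘ᵖ IN (M / C) → Indep F × A ⊆ F
    ∈block⁻ F∈ with ∈∘ᵖ⁻ {Δ = IN (M / C)} F∈
    ... | G , indG , refl = contractionIndep⇒A∪G-indep indG , p⊆p∪q G

    -- As `F` meets `C` exactly in `A`, it splits as `A ∪ (F ─ C)`.
    ∈block⁺ : ∀ {F} → Indep F → A ⊆ F → F ∈ᵖ A ∘ᵖ IN (M / C)
    ∈block⁺ {F} indF A⊆F = subst (_∈ᵖ A ∘ᵖ IN (M / C)) A∪[F─C]≡F
      (∈∘ᵖ⁺ {Δ = IN (M / C)} (λ x∈A x∈E─C → x∈p─q⇒x∉q E C x∈E─C (A⊆C x∈A))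
        ((λ x∈ → x∈p∧x∉q⇒x∈p─q (ground indF (p─q⊆p F C x∈)) (x∈p─q⇒x∉q F C x∈)) ,
         -- `A` serves as the basis of `C`: an independent subset of `C` containing `A` cannot
         -- contain `e`.
         A , (A⊆C , indA , λ B′ (B′⊆C , indB′ , A⊆B′) →
                ⊆-antisym A⊆B′ λ x∈B′ → A⊆indep⇒∩C⊆A indB′ A⊆B′ x∈B′ (B′⊆C x∈B′)) ,
         subst Indep (sym A∪[F─C]≡F) indF))
      where
      F⊆A∪[F─C] : F ⊆ A ∪ (F ─ C)
      F⊆A∪[F─C] {x} x∈F with x ∈? C
      ... | yes x∈C = p⊆p∪q (F ─ C) (A⊆indep⇒∩C⊆A indF A⊆F x∈F x∈C)
      ... | no  x∉C = q⊆p∪q A (F ─ C) (x∈p∧x∉q⇒x∈p─q x∈F x∉C)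
      A∪[F─C]≡F : A ∪ (F ─ C) ≡ F
      A∪[F─C]≡F = ⊆-antisym (∪-lub A⊆F (p─q⊆p F C)) F⊆A∪[F─C]

  -- Decomposition of the faces into blocks

  module _ (e : Fin n) where

    private
      P : Pair (E - e)
      P = (IN M ∖ᶜ e) ,ᵖ (IN M /ᶜ e)
      Q : (C : CircuitThrough M e) → Pair _
      Q C = (value C - e) ∘ᵖ IN (M / value C)

    circuitOf : (C : CircuitThrough M e) → Circuit M (value C)
    circuitOf (C , [ c ]) = recomputeCircuit (proj₁ c)

    e∈circuitOf : (C : CircuitThrough M e) → e ∈ value C
    e∈circuitOf (C , [ c ]) = recompute (e ∈? C) (proj₂ c)

    ∈Q⁻ : ∀ C {F} → F ∈ᵖ Q C → Indep F × value C - e ⊆ F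
    ∈Q⁻ C = ∈block⁻ (circuitOf C) (e∈circuitOf C)

    ∈Q⁺ : ∀ C {F} → Indep F → value C - e ⊆ F → F ∈ᵖ Q C
    ∈Q⁺ C = ∈block⁺ (circuitOf C) (e∈circuitOf C)

    ∈P⇒indep : ∀ {F} → F ∈ᵖ P → Indep F
    ∈P⇒indep ((indF , _) , _) = indF

    -- Otherwise `F`, being `(F ∪ ⁅ e ⁆) - e`, would be a face of `IN M /ᶜ e`.
    ∈P⇒∪e-dependent : ∀ {F} → F ∈ᵖ P → ¬ Indep (F ∪ ⁅ e ⁆)
    ∈P⇒∪e-dependent {F} ((_ , e∉F) , ∉small) indFe =
      ∉small (F ∪ ⁅ e ⁆ , indFe , q⊆p∪q F ⁅ e ⁆ (x∈⁅x⁆ e) ,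
        ⊆-antisym
          (λ x∈F → x∈p∧x≢y⇒x∈p-y (p⊆p∪q ⁅ e ⁆ x∈F) λ { refl → e∉F x∈F })
          (λ x∈ → [ id , (λ x∈e → contradiction x∈e (x∈p─q⇒x∉q (F ∪ ⁅ e ⁆) ⁅ e ⁆ x∈)) ]′
            (x∈p∪q⁻ F ⁅ e ⁆ (p─q⊆p (F ∪ ⁅ e ⁆) ⁅ e ⁆ x∈))))

    -- An independent set containing `C - e` avoids `e`. This applies to `F`, and also to any
    -- independent `G` with `F ≡ G - e`, which rules out `e ∈ G`.
    Q⊆P : ∀ C {F} → F ∈ᵖ Q C → F ∈ᵖ P
    Q⊆P C F∈ = let indF , A⊆F = ∈Q⁻ C F∈ in
      (indF , A⊆indep⇒e∉ (circuitOf C) (e∈circuitOf C) indF A⊆F) ,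
      λ { (G , indG , e∈G , refl) →
          A⊆indep⇒e∉ (circuitOf C) (e∈circuitOf C) indG (p─q⊆p G ⁅ e ⁆ ∘ A⊆F) e∈G }

    P-covered : e ∈ E → ∀ {F} → F ∈ᵖ P → ∃[ C ] F ∈ᵖ Q C
    P-covered e∈E {F} F∈P
      with dependent⇒circuit⊆ (∪-lub (ground (∈P⇒indep F∈P)) (x∈p⇒⁅x⁆⊆p e∈E)) (∈P⇒∪e-dependent F∈P)
    ... | C , C⊆Fe , circuit@(_ , depC , _) = (C , [ circuit , e∈C ]) , ∈block⁺ circuit e∈C indF C-e⊆F
      where
      indF = ∈P⇒indep F∈P
      e∈C : e ∈ C
      -- A circuit inside `F ∪ ⁅ e ⁆` avoiding `e` would lie in the independent set `F`.
      e∈C = decidable-stable (e ∈? C) λ e∉C → depC (hereditary indF λ x∈C →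
        [ id , (λ x∈e → contradiction (subst (_∈ C) (x∈⁅y⁆⇒x≡y e x∈e) x∈C) e∉C) ]′
          (x∈p∪q⁻ F ⁅ e ⁆ (C⊆Fe x∈C)))
      C-e⊆F : C - e ⊆ F
      C-e⊆F x∈ = [ id , (λ x∈e → contradiction x∈e (x∈p─q⇒x∉q C ⁅ e ⁆ x∈)) ]′
        (x∈p∪q⁻ F ⁅ e ⁆ (C⊆Fe (p─q⊆p C ⁅ e ⁆ x∈)))

    Q-disjoint : ∀ {C D F} → F ∈ᵖ Q C → F ∈ᵖ Q D → C ≡ D
    Q-disjoint {C} {D} F∈C F∈D = let indF , C-e⊆F = ∈Q⁻ C F∈C ; _ , D-e⊆F = ∈Q⁻ D F∈D in
      value-injective (⊆-antisym
        (fundamentalCircuit-⊆ (circuitOf C) (circuitOf D) (e∈circuitOf C) (e∈circuitOf D)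
          indF C-e⊆F D-e⊆F)
        (fundamentalCircuit-⊆ (circuitOf D) (circuitOf C) (e∈circuitOf D) (e∈circuitOf C)
          indF D-e⊆F C-e⊆F))

    P-decomposition : e ∈ E → DisjointUnion P Q
    P-decomposition e∈E = record
      { cover = P-covered e∈E ; include = Q⊆P ; disjoint = Q-disjoint }

    Q-upward : ∀ C {F G} → F ∈ᵖ Q C → F ⊆ G → G ∈ᵖ P → G ∈ᵖ Q C
    Q-upward C F∈ F⊆G G∈P = ∈Q⁺ C (∈P⇒indep G∈P) (F⊆G ∘ proj₂ (∈Q⁻ C F∈))

    -- `F` lies in the block of some `D`; going up, so does `G`, and disjointness of the blocks
    -- gives `D ≡ C`.
    Q-downward : e ∈ E → ∀ C {F G} → G ∈ᵖ Q C → F ⊆ G → F ∈ᵖ P → F ∈ᵖ Q C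
    Q-downward e∈E C {F} G∈ F⊆G F∈P with P-covered e∈E F∈P
    ... | D , F∈D = subst (λ X → F ∈ᵖ Q X)
      (Q-disjoint {D} {C} (Q-upward D F∈D F⊆G (Q⊆P C G∈)) G∈) F∈D

-- Sums and incidence coefficients

module _ {c ℓ : Level} (R : CommutativeRing c ℓ) where

  open Chains R
  open CommutativeRing R using (Carrier; _≈_; 0#; +-cong; +-congˡ; +-identityˡ; *-congˡ; *-congʳ; zeroˡ; setoid)
    renaming (refl to ≈-refl; sym to ≈-sym; trans to ≈-trans)
  open import Relation.Binary.Reasoning.Setoid setoid

  ∑-cong : {A : Set} (xs : List A) {f g : A → Carrier} → (∀ x → f x ≈ g x) → ∑ xs f ≈ ∑ xs g
  ∑-cong []       f≈g = ≈-refl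
  ∑-cong (x ∷ xs) f≈g = +-cong (f≈g x) (∑-cong xs f≈g)

  ∑-zero : {A : Set} (xs : List A) {f : A → Carrier} → (∀ x → f x ≈ 0#) → ∑ xs f ≈ 0#
  ∑-zero []       f≈0 = ≈-refl
  ∑-zero (x ∷ xs) f≈0 = ≈-trans (+-cong (f≈0 x) (∑-zero xs f≈0)) (+-identityˡ 0#)

  -- Turning discarded entries into zeros lets sums over the cells of different pairs be compared
  -- over the common list `subsets n`.
  ∑-mapMaybe : {A B : Set} (h : A → Maybe B) (xs : List A) (f : B → Carrier) →
               ∑ (mapMaybe h xs) f ≈ ∑ xs (λ x → maybe′ f 0# (h x))
  ∑-mapMaybe h []       f = ≈-refl
  ∑-mapMaybe h (x ∷ xs) f with h x
  ... | just y  = +-congˡ (∑-mapMaybe h xs f)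
  ... | nothing = ≈-trans (∑-mapMaybe h xs f) (≈-sym (+-identityˡ _))

  if-no : {A : Set} (A? : Dec A) {x : Carrier} → ¬ A → (if does A? then x else 0#) ≈ 0#
  if-no (yes a) ¬a = contradiction a ¬a
  if-no (no _)  ¬a = ≈-refl

  -- A term can be nonzero only if `G` is some `F - v`, which is a subset of `F`.
  incidence-⊈ : {G F : Subset n} → ¬ (G ⊆ F) → incidence G F ≈ 0#
  incidence-⊈ {n} {G} {F} G⊈F = ∑-zero (allFin n) λ v →
    if-no ((v ∈? F) ×-dec (G ≟ˢ (F - v))) λ { (_ , refl) → G⊈F (p─q⊆p F ⁅ v ⁆) }

  module _ (P : Pair {n} V) where

    ∂-cong : ∀ i {j} (eq : j ≡ i ℤ.- 1ℤ) {x y : Chain P i} → (∀ F → x F ≈ y F) →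
             ∀ G → ∂ P i eq x G ≈ ∂ P i eq y G
    ∂-cong i eq x≈y G = ∑-cong (cells P i) λ F → *-congˡ (x≈y F)

    ∂*-cong : ∀ i {j} (eq : j ≡ i ℤ.- 1ℤ) {x y : Chain P j} → (∀ G → x G ≈ y G) →
              ∀ F → ∂* P i eq x F ≈ ∂* P i eq y F
    ∂*-cong i {j} eq x≈y F = ∑-cong (cells P j) λ G → *-congˡ (x≈y G)

  -- Restriction to a coordinate subspace

  module _ {P : Pair {n} V} {Q : Pair {n} W} (Q⊆P : ∀ {F} → F ∈ᵖ Q → F ∈ᵖ P) where

    -- For a block of a disjoint union, with `include` as the inclusion, this is `project`.
    restrict : ∀ {i} → Chain P i → Chain Q i
    restrict x (F , [ p ]) = x (F , [ Q⊆P (proj₁ p) , proj₂ p ])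

    ∑-restrict : ∀ i (f : Chain P i) → (∀ F → ¬ (value F ∈ᵖ Q) → f F ≈ 0#) →
                 ∑ (cells P i) f ≈ ∑ (cells Q i) (restrict f)
    ∑-restrict i f f≈0 = begin
      ∑ (cells P i) f             ≈⟨ ∑-mapMaybe _ (subsets n) f ⟩
      ∑ (subsets n) (λ F → term {S = P} F f (dim∈ F P))
                                  ≈⟨ ∑-cong (subsets n) (λ F → term≈ F (dim∈ F P) (dim∈ F Q)) ⟩
      ∑ (subsets n) (λ F → term {S = Q} F (restrict f) (dim∈ F Q))
                                  ≈⟨ ∑-mapMaybe _ (subsets n) (restrict f) ⟨
      ∑ (cells Q i) (restrict f)  ∎
      where
      dim∈ : ∀ {U} F (S : Pair {n} U) → Dec ((F ∈ᵖ S) × dim F ≡ i)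
      dim∈ F S = (F ∈ᵖ? S) ×-dec (dim F ℤ.≟ i)
      term : ∀ {U} {S : Pair {n} U} F → Chain S i → Dec ((F ∈ᵖ S) × dim F ≡ i) → Carrier
      term F g d = maybe′ g 0# (Maybe.map (λ p → F , [ p ]) (dec⇒maybe d))
      term≈ : ∀ F (dP : Dec ((F ∈ᵖ P) × dim F ≡ i)) (dQ : Dec ((F ∈ᵖ Q) × dim F ≡ i)) →
              term {S = P} F f dP ≈ term {S = Q} F (restrict f) dQ
      -- Proofs inside cells are irrelevant, so both sides are the same value of `f`.
      term≈ F (yes _)          (yes _)          = ≈-refl
      term≈ F (yes (F∈P , d))  (no ∉Q)          = f≈0 _ λ F∈Q → ∉Q (F∈Q , d)
      term≈ F (no ∉P)          (yes (F∈Q , d))  = contradiction (Q⊆P F∈Q , d) ∉P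
      term≈ F (no _)           (no _)           = ≈-refl

    module _ (upward   : ∀ {F G} → F ∈ᵖ Q → F ⊆ G → G ∈ᵖ P → G ∈ᵖ Q)
             (downward : ∀ {F G} → G ∈ᵖ Q → F ⊆ G → F ∈ᵖ P → F ∈ᵖ Q) where

      -- A face `F` outside `Q` contributes nothing: a nonzero incidence needs `G ⊆ F`, and then
      -- `upward` would put `F` in `Q`.
      restrict-∂ : ∀ i {j} (eq : j ≡ i ℤ.- 1ℤ) (x : Chain P i) (G : Cell Q j) →
                   restrict (∂ P i eq x) G ≈ ∂ Q i eq (restrict x) G
      restrict-∂ i eq x (G , [ g ]) = ∑-restrict i _ λ { (F , [ p ]) F∉Q →
        ≈-trans (*-congʳ (incidence-⊈ λ G⊆F → F∉Q
          (upward (recompute (G ∈ᵖ? Q) (proj₁ g)) G⊆F (recompute (F ∈ᵖ? P) (proj₁ p)))))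
          (zeroˡ _) }

      -- The transposed sum runs over the smaller faces, so `downward` takes the place of `upward`.
      restrict-∂* : ∀ i {j} (eq : j ≡ i ℤ.- 1ℤ) (y : Chain P j) (F : Cell Q i) →
                    restrict (∂* P i eq y) F ≈ ∂* Q i eq (restrict y) F
      restrict-∂* i {j} eq y (F , [ f ]) = ∑-restrict j _ λ { (G , [ p ]) G∉Q →
        ≈-trans (*-congʳ (incidence-⊈ λ G⊆F → G∉Q
          (downward (recompute (F ∈ᵖ? Q) (proj₁ f)) G⊆F (recompute (G ∈ᵖ? P) (proj₁ p)))))
          (zeroˡ _) }

      restrict-L : ∀ i (x : Chain P i) (F : Cell Q i) →
                   restrict (L P i x) F ≈ L Q i (restrict x) F
      restrict-L i x F = +-cong
        (≈-trans (restrict-∂ (i ℤ.+ 1ℤ) i≡i+1-1 (∂* P (i ℤ.+ 1ℤ) i≡i+1-1 x) F)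
                 (∂-cong Q (i ℤ.+ 1ℤ) i≡i+1-1 (restrict-∂* (i ℤ.+ 1ℤ) i≡i+1-1 x) F))
        (≈-trans (restrict-∂* i refl (∂ P i refl x) F)
                 (∂*-cong Q i refl (restrict-∂ i refl x) F))
        where
        i≡i+1-1 : i ≡ (i ℤ.+ 1ℤ) ℤ.- 1ℤ
        i≡i+1-1 = sym (trans (ℤ.+-assoc i 1ℤ (ℤ.- 1ℤ)) (ℤ.+-identityʳ i))

  -- `⨁` computes the coordinate at `F` in the block that `cover` picks for `F`, so the claim is
  -- `restrict-L` for that one block.
  L-decomposition : {P : Pair {n} V} {K : Set} {W : K → Subset n} {Q : ∀ k → Pair (W k)}
    (D : DisjointUnion P Q) →
    (∀ k {F G} → F ∈ᵖ Q k → F ⊆ G → G ∈ᵖ P → G ∈ᵖ Q k) →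
    (∀ k {F G} → G ∈ᵖ Q k → F ⊆ G → F ∈ᵖ P → F ∈ᵖ Q k) →
    ∀ i → EqualOn P i (L P i) (⨁ D (λ k → L (Q k) i))
  L-decomposition {P = P} {Q = Q} D upward downward i x (F , [ p ]) =
    let k , F∈Qk = cover (recompute (F ∈ᵖ? P) (proj₁ p))
    in restrict-L {P = P} {Q = Q k} (include k) (upward k) (downward k) i x (F , [ F∈Qk , proj₂ p ])
    where open DisjointUnion D

lemma3p3 : ∀ {c ℓ : Level} (R : CommutativeRing c ℓ) → let open Chains R in
    {n : ℕ} {E : Subset n} (M : Matroid E) (e : Fin n) → e ∈ E → ¬ Loop M e →
    let P = (IN M ∖ᶜ e) ,ᵖ (IN M /ᶜ e)
        Q = λ (C : CircuitThrough M e) → (value C - e) ∘ᵖ IN (M / value C)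
    in Σ[ D ∈ DisjointUnion P Q ]
         (∀ (i : ℤ) → EqualOn P i (L P i) (⨁ D (λ C → L (Q C) i)))
lemma3p3 R M e e∈E _ =
  P-decomposition M e e∈E ,
  L-decomposition R
    {P = (IN M ∖ᶜ e) ,ᵖ (IN M /ᶜ e)} {Q = λ C → (value C - e) ∘ᵖ IN (M / value C)}
    (P-decomposition M e e∈E) (Q-upward M e) (Q-downward M e e∈E)
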